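{- Let $d\ge 1$, let $\Sigma$ be a finite alphabet, and let $G:\Sigma^{\mathbb{Z}^d}\to\Sigma^{\mathbb{Z}^d}$ be a locally time-symmetric cellular automaton with respect to an involution $h$ of $\Sigma$; that is, $G$ is a reversible cellular automaton with $G^{ -1}=H\circ G\circ H$, where $H$ applies $h$ to every cell. For $i\in\mathbb{Z}^d$ let $h_i$ be the map on $\Sigma^{\mathbb{Z}^d}$ that applies $h$ to cell $i$ and leaves all other cells unchanged, and let $L_i=G^{ -1}\circ h_i\circ G$. Then $$G^2=H\circ\prod_{i\in\mathbb{Z}^d}L_i,$$ and furthermore $\mathrm{Loc}(L_0)\subseteq\mathcal{BN}$, where $\mathcal{BN}$ is the block neighborhood of $G$.
   Context: A reversible cellular automaton (RCA) over a finite alphabet $\Sigma$ on $\mathbb{Z}^d$ is a bijection $G$ of $\Sigma^{\mathbb{Z}^d}$ that commutes with all translations and is causal (there is a finite $\mathcal{N}\subset\mathbb{Z}^d$ such that $G(c)_0$ depends only on $c|_{\mathcal{N}}$), and whose inverse $G^{ -1}$ has the same properties. A locally time-symmetric CA (LTSCA) is an RCA $G$ for which there exists an involution $h:\Sigma\to\Sigma$ ($h\circ h=\mathrm{id}$) such that $G^{ -1}=H\circ G\circ H$, where $H=\prod_i h_i$ is the map $H(c)_i=h(c_i)$ for all $i\in\mathbb{Z}^d$. Localization: let $X$ be a set of cells and $f$ a bijection of $\Sigma^X$. For $Y\subseteq X$, $f$ is localized upon $Y$ if $f=f_Y\times\mathrm{id}_{X\setminus Y}$ for some bijection $f_Y$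 of $\Sigma^Y$ (identifying $\Sigma^X=\Sigma^Y\times\Sigma^{X\setminus Y}$). $\mathrm{Loc}(f)$ denotes the smallest (for inclusion) $Y\subseteq X$ upon which $f$ is localized. Semilocalizability: a bijection $F:A\times B\to C\times D$ is semilocalizable (with respect to these decompositions) if there are a set $E$ and bijections $g:A\to C\times E$ and $\tilde h:E\times B\to D$ such that $F=(\mathrm{id}_C\times\tilde h)\circ(g\times\mathrm{id}_B)$. Block neighborhood: $\mathcal{BN}$ is the smallest subset of $\mathbb{Z}^d$ such that $G$, viewed as a bijection $\Sigma^{\mathcal{BN}}\times\Sigma^{\mathbb{Z}^d\setminus\mathcal{BN}}\to\Sigma^{\{0\}}\times\Sigma^{\mathbb{Z}^d\setminus\{0\}}$, is semilocalizable. It is known that this smallest set exists and is finite. Infinite product: for a family of pairwise commuting bijections $(f_i)_i$ of $\Sigma^X$, each localized upon a finite set and such that every $x\in X$ lies in $\mathrm{Loc}(f_i)$ for only finitely many $i$, the product $\prod_i f_i$ is the map whose value at a configuration $w$ and cell $x$ is the common value of $\bigl(\prod_{i\in I}f_i\bigr)(w)_x$ for all sufficiently large finite index sets $I$. The maps $L_i$ form such a family. -}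

module Defs where

open import Algebra.Definitions using (Involutive)
open import Data.Bool using (Bool; true; false; T; not)
open import Data.Fin using (Fin)
open import Data.Integer using (ℤ; 0ℤ)
import Data.Integer as ℤ
open import Data.Irrelevant using ([_])
open import Data.List using (List; foldr)
open import Data.List.Membership.Propositional using () renaming (_∈_ to _∈ˡ_)
open import Data.List.Relation.Binary.Subset.Propositional using () renaming (_⊆_ to _⊆ˡ_)
open import Data.List.Relation.Unary.Unique.Propositional using (Unique)
open import Data.Nat using (ℕ)
open import Data.Product using (_×_; _,_; ∃-syntax)
open import Data.Product.Function.NonDependent.Setoid using (_×-inverse_)
open import Data.Product.Relation.Binary.Pointwise.NonDependent using (_×ₛ_)
open import Data.Refinement using (Refinement; _,_; value)
open import Data.Unit using (tt)
open import Data.Vec using (Vec; replicate; zipWith)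
open import Data.Vec.Properties using (≡-dec)
open import Function using (Inverse; _↔_; _∘_)
import Function.Construct.Composition as Composition
import Function.Construct.Identity as Identity
import Function.Construct.Symmetry as Symmetry
open import Level using (0ℓ)
open import Relation.Binary using (Setoid; DecidableEquality)
open import Relation.Binary.PropositionalEquality
  using (_≡_; _≗_; refl; trans; cong; _→-setoid_)
open import Relation.Nullary using (yes; no; does)

open Inverse using (to; from)

private variable
  A I X : Set

IsFinite : Set → Set
IsFinite A = ∃[ n ] (A ↔ Fin n)

-- Bijections are invertible maps of setoids, since configurations are
-- functions and are compared pointwise.

Bij : Setoid 0ℓ 0ℓ → Setoid 0ℓ 0ℓ → Set
Bij = Inverse

infixr 9 _⊚_
_⊚_ : ∀ {S T U} → Bij T U → Bij S T → Bij S U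
g ⊚ f = Composition.inverse f g

inv : ∀ {S T} → Bij S T → Bij T S
inv = Symmetry.inverse

idᵇ : ∀ {S} → Bij S S
idᵇ {S} = Identity.inverse S

-- Subsets have decidable membership: this is what makes A^X ≅ A^Y × A^(X∖Y)
-- an actual bijection.

Subset : Set → Set
Subset X = X → Bool

infix 4 _∈_ _⊆_
_∈_ : X → Subset X → Set
x ∈ Y = T (Y x)

_⊆_ : Subset X → Subset X → Set
Y ⊆ Z = ∀ x → x ∈ Y → x ∈ Z

∁ : Subset X → Subset X
∁ Y = not ∘ Y

IsSmallest : ∀ {ℓ} → (Subset X → Set ℓ) → Subset X → Set ℓ
IsSmallest P Y = P Y × (∀ Z → P Z → Y ⊆ Z)

Config : Set → Set → Setoid 0ℓ 0ℓ
Config A X = X →-setoid A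

infixl 8 _^_
_^_ : (A : Set) → Subset X → Setoid 0ℓ 0ℓ
A ^ Y = Config A (Refinement _ (_∈ Y))

restrict : (Y : Subset X) → (X → A) → (Refinement X (_∈ Y) → A)
restrict Y c y = c (value y)

private
  merge : (b : Bool) → (.(T b) → A) → (.(T (not b)) → A) → A
  merge true  f g = f tt
  merge false f g = g tt

  merge-cong : ∀ b {f f′ : .(T b) → A} {g g′ : .(T (not b)) → A} →
               (∀ .p → f p ≡ f′ p) → (∀ .p → g p ≡ g′ p) →
               merge b f g ≡ merge b f′ g′
  merge-cong true  f≗ g≗ = f≗ tt
  merge-cong false f≗ g≗ = g≗ tt

  merge-const : ∀ b {a : A} → merge b (λ _ → a) (λ _ → a) ≡ a
  merge-const true  = refl
  merge-const false = refl

  merge-inside : ∀ b {f : .(T b) → A} {g : .(T (not b)) → A} .(p : T b) →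
                 merge b f g ≡ f p
  merge-inside true p = refl

  merge-outside : ∀ b {f : .(T b) → A} {g : .(T (not b)) → A} .(p : T (not b)) →
                  merge b f g ≡ g p
  merge-outside false p = refl

glue : (Y : Subset X) →
       (Refinement X (_∈ Y) → A) → (Refinement X (_∈ ∁ Y) → A) → (X → A)
glue Y a b x = merge (Y x) (λ p → a (x , [ p ])) (λ p → b (x , [ p ]))

split : (Y : Subset X) → Bij (Config A X) ((A ^ Y) ×ₛ (A ^ ∁ Y))
split Y = record
  { to        = λ c → restrict Y c , restrict (∁ Y) c
  ; from      = λ (a , b) → glue Y a b
  ; to-cong   = λ c≗c′ → (λ y → c≗c′ (value y)) , (λ y → c≗c′ (value y))
  ; from-cong = λ (a≗a′ , b≗b′) x →
      merge-cong (Y x) (λ p → a≗a′ (x , [ p ])) (λ p → b≗b′ (x , [ p ]))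
  ; inverse   =
      (λ c≗ → (λ { (x , [ p ]) → trans (c≗ x) (merge-inside (Y x) p) })
            , (λ { (x , [ p ]) → trans (c≗ x) (merge-outside (Y x) p) }))
    , (λ (a≗ , b≗) x → trans
        (merge-cong (Y x) (λ p → a≗ (x , [ p ])) (λ p → b≗ (x , [ p ])))
        (merge-const (Y x)))
  }

infix 4 _≈ᵇ_
_≈ᵇ_ : ∀ {S T} → Bij S T → Bij S T → Set
_≈ᵇ_ {S} {T} f g = ∀ s → Setoid._≈_ T (to f s) (to g s)

LocalizedUpon : Bij (Config A X) (Config A X) → Subset X → Set
LocalizedUpon {A} f Y = ∃[ fY ] f ≈ᵇ inv (split Y) ⊚ (fY ×-inverse idᵇ {A ^ ∁ Y}) ⊚ split Y

IsLoc : Bij (Config A X) (Config A X) → Subset X → Set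
IsLoc f = IsSmallest (LocalizedUpon f)

Semilocalizable : ∀ {A B C D} → Bij (A ×ₛ B) (C ×ₛ D) → Set₁
Semilocalizable {A} {B} {C} {D} F =
  ∃[ E ] ∃[ g ] ∃[ h̃ ] (∀ a b → to F (a , b) ≈ factored {E} g h̃ a b)
  where
  open Setoid (C ×ₛ D) using (_≈_)

  factored : ∀ {E} → Bij A (C ×ₛ E) → Bij (E ×ₛ B) D →
             Setoid.Carrier A → Setoid.Carrier B → Setoid.Carrier (C ×ₛ D)
  factored g h̃ a b = let (c , e) = to g a in c , to h̃ (e , b)

∏ : List I → (I → Bij (Config A X) (Config A X)) → Bij (Config A X) (Config A X)
∏ J f = foldr (λ i g → f i ⊚ g) idᵇ J

-- Finite index sets are duplicate-free lists.  All orderings of an index set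
-- are quantified over, so for a commuting family the choice is immaterial.

IsInfiniteProduct : (I → Bij (Config A X) (Config A X)) → ((X → A) → (X → A)) → Set
IsInfiniteProduct f P =
  ∀ w x → ∃[ J₀ ] (∀ J → Unique J → J₀ ⊆ˡ J → to (∏ J f) w x ≡ P w x)

Cell : ℕ → Set
Cell d = Vec ℤ d

module _ {d : ℕ} where

  infix 4 _≟ᶜ_
  _≟ᶜ_ : DecidableEquality (Cell d)
  _≟ᶜ_ = ≡-dec ℤ._≟_

  origin : Cell d
  origin = replicate d 0ℤ

  ⁅_⁆ : Cell d → Subset (Cell d)
  ⁅ i ⁆ x = does (x ≟ᶜ i)

  translate : Cell d → (Cell d → A) → (Cell d → A)
  translate v c x = c (zipWith ℤ._+_ x v)

  record IsCA (F : (Cell d → A) → (Cell d → A)) : Set where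
    field
      commutes-with-translations : ∀ v c → F (translate v c) ≗ translate v (F c)
      causal : ∃[ N ] (∀ c c′ → (∀ x → x ∈ˡ N → c x ≡ c′ x) → F c origin ≡ F c′ origin)

  record IsRCA (G : Bij (Config A (Cell d)) (Config A (Cell d))) : Set where
    field
      isCA         : IsCA (to G)
      inverse-isCA : IsCA (from G)

  IsBlockNeighborhood : Bij (Config A (Cell d)) (Config A (Cell d)) →
                        Subset (Cell d) → Set₁
  IsBlockNeighborhood G =
    IsSmallest (λ N → Semilocalizable (split ⁅ origin ⁆ ⊚ G ⊚ inv (split N)))

  module _ (h : A → A) where

    H : (Cell d → A) → (Cell d → A)
    H c x = h (c x)

    record IsLTSCA (G : Bij (Config A (Cell d)) (Config A (Cell d))) : Set where
      field
        isRCA          : IsRCA G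
        time-symmetric : ∀ c → from G c ≗ H (to G (H c))

    applyAt : Cell d → (Cell d → A) → (Cell d → A)
    applyAt i c x with x ≟ᶜ i
    ... | yes _ = h (c x)
    ... | no  _ = c x

    module _ (h-inv : Involutive _≡_ h) where

      private
        applyAt-cong : ∀ i {c c′} → c ≗ c′ → applyAt i c ≗ applyAt i c′
        applyAt-cong i c≗c′ x with x ≟ᶜ i
        ... | yes _ = cong h (c≗c′ x)
        ... | no  _ = c≗c′ x

        applyAt-involutive : ∀ i c → applyAt i (applyAt i c) ≗ c
        applyAt-involutive i c x with x ≟ᶜ i in eq
        ... | yes _ rewrite eq = h-inv (c x)
        ... | no  _ rewrite eq = refl

      h[_] : Cell d → Bij (Config A (Cell d)) (Config A (Cell d))
      h[ i ] = record
        { to        = applyAt i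
        ; from      = applyAt i
        ; to-cong   = applyAt-cong i
        ; from-cong = applyAt-cong i
        ; inverse   = cancel , cancel
        }
        where
        cancel : ∀ {c c′} → c′ ≗ applyAt i c → applyAt i c′ ≗ c
        cancel {c} eq x = trans (applyAt-cong i eq x) (applyAt-involutive i c x)

      L : Bij (Config A (Cell d)) (Config A (Cell d)) →
          Cell d → Bij (Config A (Cell d)) (Config A (Cell d))
      L G i = inv G ⊚ h[ i ] ⊚ G

{-# OPTIONS --safe #-}
module Submission where

-- Conjugating by G turns a finite product of the Lᵢ into G⁻¹ ∘ ∏ hᵢ ∘ G.  Since
-- G⁻¹ is causal, its value at x only sees finitely many of the hᵢ, so the infinite
-- product is G⁻¹ ∘ H ∘ G = H ∘ G².  For the localization, semilocalizability
-- writes G (a , b) as (c , h̃ (e , b)) with (c , e) = g a; as h₀ only changes c, L₀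
-- replaces a by g⁻¹ (h c , e) and leaves b alone.

open import Defs
open import Algebra.Definitions using (Involutive)
open import Data.Empty.Irrelevant using (⊥-elim)
import Data.Integer as ℤ
open import Data.Integer.Properties using (+-identityˡ)
open import Data.Irrelevant using ([_])
open import Data.List using ([]; _∷_; map)
open import Data.List.Membership.Propositional using () renaming (_∈_ to _∈ˡ_)
open import Data.List.Membership.Propositional.Properties using (∈-map⁺)
open import Data.List.Relation.Unary.All using (lookup)
open import Data.List.Relation.Unary.AllPairs using ([]; _∷_)
open import Data.List.Relation.Unary.Any using (here; there)
open import Data.List.Relation.Unary.Unique.Propositional using (Unique)
open import Data.Nat using (ℕ; _≤_)
open import Data.Product using (_×_; _,_; proj₁; proj₂; ∃-syntax)
open import Data.Product.Function.NonDependent.Setoid using (_×-inverse_)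
open import Data.Product.Relation.Binary.Pointwise.NonDependent using (_×ₛ_)
open import Data.Refinement using (_,_)
open import Data.Vec using (zipWith)
open import Data.Vec.Properties using (zipWith-identityˡ)
open import Function using (Inverse; _∘_)
open import Relation.Binary using (Setoid)
open import Relation.Binary.PropositionalEquality
  using (_≡_; _≢_; _≗_; refl; sym; trans; cong)
open import Relation.Nullary using (yes; no; contradiction)
open Inverse using (to; from; to-cong; from-cong; inverseˡ; inverseʳ)

private variable
  A I X : Set
  d : ℕ

to-injective : ∀ {S T} (f : Bij S T) {x y} →
               Setoid._≈_ T (to f x) (to f y) → Setoid._≈_ S x y
to-injective {S} {T} f fx≈fy =
  Setoid.trans S (Setoid.sym S (inverseʳ f (Setoid.refl T)))
                 (inverseʳ f fx≈fy)

∏-conjugate : (G : Bij (Config A X) (Config A X)) (f : I → Bij (Config A X) (Config A X)) →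
              ∀ J → ∏ J (λ i → inv G ⊚ f i ⊚ G) ≈ᵇ inv G ⊚ ∏ J f ⊚ G
∏-conjugate G f []      w x = sym (inverseʳ G (λ _ → refl) x)
∏-conjugate G f (j ∷ J) w   =
  -- The `G` of the head factor meets the `inv G` that closes the tail; `inverseˡ` cancels the pair.
  from-cong G (to-cong (f j) (inverseˡ G (∏-conjugate G f J w)))

CA-at : {F : (Cell d → A) → (Cell d → A)} → IsCA F →
        ∀ x c → F c x ≡ F (translate x c) origin
CA-at {F = F} isCA x c =
  -- `translate x (F c) origin` unfolds to `F c` at `origin` plus `x`, a cell that equals `x` only
  -- propositionally.
  trans (cong (F c) (sym (zipWith-identityˡ +-identityˡ x)))
        (sym (IsCA.commutes-with-translations isCA x c origin))

-- Causality is given at the origin alone; shifting the neighborhood by `x` carries it to the cell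
-- `x`.
causal-at : {F : (Cell d → A) → (Cell d → A)} → IsCA F → ∀ x →
            ∃[ N ] (∀ c c′ → (∀ y → y ∈ˡ N → c y ≡ c′ y) → F c x ≡ F c′ x)
causal-at isCA x with IsCA.causal isCA
... | N , depends-on-N =
  map x+_ N , λ c c′ c≗c′ →
    trans (CA-at isCA x c)
      (trans (depends-on-N _ _ (λ y y∈N → c≗c′ (x+ y) (∈-map⁺ x+_ y∈N)))
             (sym (CA-at isCA x c′)))
  where
  x+_ = λ y → zipWith ℤ._+_ y x

module _ {d : ℕ} {A : Set} (h : A → A) where

  applyAt-≡ : (i : Cell d) (c : Cell d → A) → applyAt h i c i ≡ h (c i)
  applyAt-≡ i c with i ≟ᶜ i
  ... | yes _  = refl
  ... | no i≢i = contradiction refl i≢i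

  applyAt-≢ : ∀ {i x : Cell d} (c : Cell d → A) → x ≢ i → applyAt h i c x ≡ c x
  applyAt-≢ {i = i} {x} c x≢i with x ≟ᶜ i
  ... | yes x≡i = contradiction x≡i x≢i
  ... | no _    = refl

  split-applyAt : (i : Cell d) (c : Cell d → A) →
    let (a , b) = to (split ⁅ i ⁆) c in
    Setoid._≈_ ((A ^ ⁅ i ⁆) ×ₛ (A ^ ∁ ⁅ i ⁆)) (to (split ⁅ i ⁆) (applyAt h i c)) (h ∘ a , b)
  split-applyAt i c = (λ (x , [ p ]) → inside x p) , (λ (x , [ p ]) → outside x p)
    where
    inside : ∀ x → .(x ∈ ⁅ i ⁆) → applyAt h i c x ≡ h (c x)
    inside x p with x ≟ᶜ i
    ... | yes _ = refl
    ... | no  _ = ⊥-elim p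

    outside : ∀ x → .(x ∈ ∁ ⁅ i ⁆) → applyAt h i c x ≡ c x
    outside x p with x ≟ᶜ i
    ... | yes _ = ⊥-elim p
    ... | no  _ = refl

  module _ (h-inv : Involutive _≡_ h) where

    ∏-h-∉ : ∀ J (c : Cell d → A) {x} → (∀ {j} → j ∈ˡ J → x ≢ j) →
            to (∏ J (h[_] h h-inv)) c x ≡ c x
    ∏-h-∉ []      c x∉J = refl
    ∏-h-∉ (j ∷ J) c x∉J =
      trans (applyAt-≢ _ (x∉J (here refl))) (∏-h-∉ J c (x∉J ∘ there))

    -- Uniqueness makes exactly one factor act on the cell `x`; a second occurrence would undo the
    -- first, since `h` is an involution.
    ∏-h-∈ : ∀ {J} → Unique J → ∀ (c : Cell d → A) {x} → x ∈ˡ J →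
            to (∏ J (h[_] h h-inv)) c x ≡ h (c x)
    ∏-h-∈ {J = j ∷ J} (j∉J ∷ _) c (here refl) =
      trans (applyAt-≡ j _) (cong h (∏-h-∉ J c (lookup j∉J)))
    ∏-h-∈ (j∉J ∷ J!) c (there x∈J) =
      trans (applyAt-≢ _ (λ x≡j → lookup j∉J x∈J (sym x≡j))) (∏-h-∈ J! c x∈J)

    ∏-L : (G : Bij (Config A (Cell d)) (Config A (Cell d))) → IsCA (from G) →
          IsInfiniteProduct (L h h-inv G) (from G ∘ H h ∘ to G)
    ∏-L G isCA w x with causal-at isCA x
    -- The threshold index set is the neighborhood that `from G` reads at `x`: once `J` covers it,
    -- the product of the `h[ j ]` agrees with `H h` there.
    ... | N , depends-on-N = N , λ J J! N⊆J →
      trans (∏-conjugate G (h[_] h h-inv) J w x)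
            (depends-on-N _ _ (λ y y∈N → ∏-h-∈ J! (to G w) (N⊆J y∈N)))

    L-localized : (G : Bij (Config A (Cell d)) (Config A (Cell d))) (i : Cell d)
                  (N : Subset (Cell d)) →
                  Semilocalizable (split ⁅ i ⁆ ⊚ G ⊚ inv (split N)) →
                  LocalizedUpon (L h h-inv G i) N
    L-localized G i N (E , g , h̃ , factors) =
      -- `inverseʳ G` moves `inv G` to the other side, leaving `applyAt h i (to G s) ≗ to G t`,
      -- which is checked after splitting off the cell `i`.
      f , λ s → inverseʳ G (to-injective (split ⁅ i ⁆) (same-image s))
      where
      C×D = (A ^ ⁅ i ⁆) ×ₛ (A ^ ∁ ⁅ i ⁆)

      h-on-cell : Bij (A ^ ⁅ i ⁆) (A ^ ⁅ i ⁆)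
      h-on-cell = record
        { to        = h ∘_
        ; from      = h ∘_
        ; to-cong   = cong h ∘_
        ; from-cong = cong h ∘_
        ; inverse   = (λ eq y → trans (cong h (eq y)) (h-inv _))
                    , (λ eq y → trans (cong h (eq y)) (h-inv _))
        }

      f : Bij (A ^ N) (A ^ N)
      f = inv g ⊚ (h-on-cell ×-inverse idᵇ {E}) ⊚ g

      module _ (s : Cell d → A) where
        open Setoid C×D using (_≈_) renaming (trans to ≈-trans; sym to ≈-sym)

        a = proj₁ (to (split N) s)
        b = proj₂ (to (split N) s)
        c = proj₁ (to g a)
        e = proj₂ (to g a)
        t = from (split N) (to f a , b)

        split-Gs : to (split ⁅ i ⁆) (to G s) ≈ (c , to h̃ (e , b))
        split-Gs = ≈-trans
          -- `factors` speaks of glued configurations, so `s` is first rewritten as the gluing of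
          -- its two restrictions.
          (to-cong (split ⁅ i ⁆ ⊚ G)
            (λ x → sym (inverseʳ (split N) {x = s} ((λ _ → refl) , (λ _ → refl)) x)))
          (factors a b)

        g-f : Setoid._≈_ ((A ^ ⁅ i ⁆) ×ₛ E) (to g (to f a)) (h ∘ c , e)
        g-f = inverseˡ g (Setoid.refl (A ^ N))

        -- Both `e` and `b` are the same for `t` as for `s`, hence so is the component computed by
        -- `h̃`.
        split-Gt : to (split ⁅ i ⁆) (to G t) ≈ (h ∘ c , to h̃ (e , b))
        split-Gt = ≈-trans (factors (to f a) b)
          (proj₁ g-f , to-cong h̃ (proj₂ g-f , (λ _ → refl)))

        same-image : to (split ⁅ i ⁆) (applyAt h i (to G s)) ≈ to (split ⁅ i ⁆) (to G t)
        same-image = ≈-trans (split-applyAt i (to G s))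
          (≈-trans (cong h ∘ proj₁ split-Gs , proj₂ split-Gs) (≈-sym split-Gt))

corollary2 : ∀ {d : ℕ} → 1 ≤ d →
    ∀ {A : Set} → IsFinite A →
    (h : A → A) (h-inv : Involutive _≡_ h) →
    (G : Bij (Config A (Cell d)) (Config A (Cell d))) → IsLTSCA h G →
    (∃[ P ] (IsInfiniteProduct (L h h-inv G) P × (∀ w → to G (to G w) ≗ H h (P w))))
    × (∀ BN → IsBlockNeighborhood G BN →
    ∀ Y → IsLoc (L h h-inv G origin) Y → Y ⊆ BN)
corollary2 _ _ h h-inv G ltsca =
    (from G ∘ H h ∘ to G , ∏-L h h-inv G (IsRCA.inverse-isCA isRCA) , square)
  , λ BN (semilocalizable , _) Y (_ , Y-least) →
      -- The smallest localizing set lies in every localizing set, and `BN` is one of them.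
      Y-least BN (L-localized h h-inv G origin BN semilocalizable)
  where
  open IsLTSCA ltsca

  -- Time symmetry at `H h (to G w)` turns H G⁻¹ H G into H H G H H G, where each adjacent pair of H
  -- cancels.
  square : ∀ w → to G (to G w) ≗ H h (from G (H h (to G w)))
  square w x = sym (trans (cong h (time-symmetric (H h (to G w)) x))
    (trans (h-inv _) (to-cong G (λ y → h-inv (to G w y)) x)))
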